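{- There is a constant $c$ such that for every basic Boolean formula $\phi$ whose variables are among $v_1,\dots,v_n$ there exists an instruction sequence $X\in\mathrm{IS}^{na}_{br}$ in which the basic instruction $\mathrm{out}.\mathrm{set}{:}F$ does not occur (in any plain, positive test or negative test instruction) such that $X$ computes the $n$-ary Boolean function induced by $\phi$ and $|X|\le c\cdot(\mathrm{size}(\phi)+1)$.
   Context: $\mathbb B=\{T,F\}$. A basic Boolean formula is a propositional formula built from variables $v_1,v_2,\dots$ using only the connectives $\neg,\vee,\wedge$; its size is the number of occurrences of variables and connectives. The $n$-ary Boolean function induced by $\phi$ (variables among $v_1,\dots,v_n$) maps $(b_1,\dots,b_n)$ to $T$ iff $\phi$ is true under $v_j\mapsto b_j$. A primitive instruction is one of: a plain basic instruction $a$, a positive test instruction $+a$, a negative test instruction $-a$ (for a basic instruction $a$), a forward jump instruction $\#l$ ($l\in\mathbb N$), or the termination instruction $!$. An instruction sequence is a finite nonempty sequence $X=u_1;\dots;u_k$ of primitive instructions; its length is $|X|=k$. Basic instructions have the form $f.m$ where the focus $f$ is one of $\mathrm{in}{:}i$, $\mathrm{aux}{:}i$ ($i\ge 1$) or $\mathrm{out}$, each naming a Boolean register, and the method $m$ is one of $\mathrm{set}{:}T$, $\mathrm{set}{:}F$, $\mathrm{get}$. Executing $f.\mathrm{set}{:}b$ sets register $f$ to $b$ and yields reply $b$; executing $f.\mathrm{get}$ leaves the register unchanged and yields its content as reply. Execution of $X=u_1;\dots;u_k$: a counter starts at $1$. If the counter exceeds $k$, execution deadlocks. At position $i$: if $u_i=!$,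 execution terminates; if $u_i=\#l$, execution deadlocks if $l=0$ and otherwise the counter becomes $i+l$; if $u_i$ is $a$, $+a$ or $-a$, the basic instruction $a$ is executed yielding reply $r$, and the counter becomes $i+1$ for $u_i=a$; for $u_i=+a$ it becomes $i+1$ if $r=T$ and $i+2$ if $r=F$; for $u_i=-a$ it becomes $i+1$ if $r=F$ and $i+2$ if $r=T$. $\mathrm{IS}_{br}$ is the set of instruction sequences in which every basic instruction occurring belongs to $\{f.\mathrm{get}: f=\mathrm{in}{:}i \text{ or } f=\mathrm{aux}{:}i\}\cup\{f.\mathrm{set}{:}b: f=\mathrm{aux}{:}i \text{ or } f=\mathrm{out},\ b\in\mathbb B\}$. $\mathrm{IS}^{na}_{br}\subseteq \mathrm{IS}_{br}$ is the set of those in which every basic instruction belongs to $\{\mathrm{in}{:}i.\mathrm{get}: i\ge1\}\cup\{\mathrm{out}.\mathrm{set}{:}T,\mathrm{out}.\mathrm{set}{:}F\}$. $X\in\mathrm{IS}_{br}$ computes $f:\mathbb B^n\to\mathbb B$ if for every $(b_1,\dots,b_n)\in\mathbb B^n$: when $X$ is executed with register $\mathrm{in}{:}j$ initialised to $b_j$ ($j\le n$) and all registers $\mathrm{aux}{:}i$ and $\mathrm{out}$ initialised to $F$, execution terminates (does not deadlock) without ever executing a basic instruction with focus $\mathrm{in}{:}j$ for $j>n$, and at termination register $\mathrm{out}$ contains $f(b_1,\dots,b_n)$. -}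

module Defs where

open import Data.Bool.Base as Bool using (Bool; true; false; if_then_else_)
open import Data.Fin.Base using (Fin; toℕ; fromℕ<)
open import Data.List.Base using (List; []; _∷_; head; drop)
open import Data.List.NonEmpty.Base using (List⁺; toList)
open import Data.List.Relation.Unary.All using (All)
open import Data.List.Relation.Unary.Any using (Any)
open import Data.Maybe.Base using (Maybe; just)
open import Data.Nat.Base using (ℕ; suc; _+_; _<_)
import Data.Nat.Properties as ℕ
open import Data.Product.Base using (∃₂; _×_)
open import Data.Vec.Base using (Vec; lookup)
open import Relation.Binary.Definitions using (DecidableEquality)
open import Relation.Binary.PropositionalEquality using (_≡_; refl; cong)
open import Relation.Nullary.Decidable using (yes; no; does; map′)

-- Variables, registers and positions are numbered from 1 in the mathematics
-- and from 0 here: var i is v_{i+1}, inp i is in:(i+1), aux i is aux:(i+1),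
-- and the first primitive instruction is at position 0.

data Formula : Set where
  var  : ℕ → Formula
  neg  : Formula → Formula
  _or_ _and_ : Formula → Formula → Formula

size : Formula → ℕ
size (var i)   = 1
size (neg φ)   = 1 + size φ
size (φ or ψ)  = 1 + (size φ + size ψ)
size (φ and ψ) = 1 + (size φ + size ψ)

data VariablesAmong (n : ℕ) : Formula → Set where
  var  : ∀ {i} → i < n → VariablesAmong n (var i)
  neg  : ∀ {φ} → VariablesAmong n φ → VariablesAmong n (neg φ)
  _or_ : ∀ {φ ψ} → VariablesAmong n φ → VariablesAmong n ψ →
         VariablesAmong n (φ or ψ)
  _and_ : ∀ {φ ψ} → VariablesAmong n φ → VariablesAmong n ψ →
          VariablesAmong n (φ and ψ)

induced : ∀ {n} (φ : Formula) → VariablesAmong n φ → Vec Bool n → Bool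
induced (var i)   (var i<n) bs = lookup bs (fromℕ< i<n)
induced (neg φ)   (neg p)   bs = Bool.not (induced φ p bs)
induced (φ or ψ)  (p or q)  bs = induced φ p bs Bool.∨ induced ψ q bs
induced (φ and ψ) (p and q) bs = induced φ p bs Bool.∧ induced ψ q bs

data Focus : Set where
  inp aux : ℕ → Focus
  out     : Focus

data Method : Set where
  set : Bool → Method
  get : Method

infix 9 _∙_

data Basic : Set where
  _∙_ : Focus → Method → Basic

infix 8 +_ -_ #_

data Instruction : Set where
  plain : Basic → Instruction
  +_ -_ : Basic → Instruction
  #_    : ℕ → Instruction
  !     : Instruction

InstructionSequence : Set
InstructionSequence = List⁺ Instruction

data _Contains_ : Instruction → Basic → Set where
  plain : ∀ {a} → plain a Contains a
  pos   : ∀ {a} → (+ a) Contains a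
  neg   : ∀ {a} → (- a) Contains a

_OccursIn_ : Basic → InstructionSequence → Set
a OccursIn X = Any (_Contains a) (toList X)

data BrBasic : Basic → Set where
  inp-get : ∀ {i} → BrBasic (inp i ∙ get)
  aux-get : ∀ {i} → BrBasic (aux i ∙ get)
  aux-set : ∀ {i b} → BrBasic (aux i ∙ set b)
  out-set : ∀ {b} → BrBasic (out ∙ set b)

data NaBasic : Basic → Set where
  inp-get : ∀ {i} → NaBasic (inp i ∙ get)
  out-set : ∀ {b} → NaBasic (out ∙ set b)

ISbr : InstructionSequence → Set
ISbr X = ∀ {a} → a OccursIn X → BrBasic a

ISbrⁿᵃ : InstructionSequence → Set
ISbrⁿᵃ X = ∀ {a} → a OccursIn X → NaBasic a

ISbrⁿᵃ⊆ISbr : ∀ {X} → ISbrⁿᵃ X → ISbr X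
ISbrⁿᵃ⊆ISbr na a∈X with na a∈X
... | inp-get = inp-get
... | out-set = out-set

_≟_ : DecidableEquality Focus
inp i ≟ inp j = map′ (cong inp) (λ { refl → refl }) (i ℕ.≟ j)
inp i ≟ aux j = no λ ()
inp i ≟ out   = no λ ()
aux i ≟ inp j = no λ ()
aux i ≟ aux j = map′ (cong aux) (λ { refl → refl }) (i ℕ.≟ j)
aux i ≟ out   = no λ ()
out   ≟ inp j = no λ ()
out   ≟ aux j = no λ ()
out   ≟ out   = yes refl

State : Set
State = Focus → Bool

effect : Basic → State → State
effect (f ∙ set b) s g = if does (f ≟ g) then b else s g
effect (f ∙ get)   s   = s

reply : Basic → State → Bool
reply (f ∙ set b) s = b
reply (f ∙ get)   s = s f

fetch : InstructionSequence → ℕ → Maybe Instruction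
fetch X i = head (drop i (toList X))

-- Run X i s t s′: execution of X from counter i and state s terminates in
-- state s′, and t lists the basic instructions executed on the way.  Deadlock
-- (a jump #0, or a counter beyond the end of X) is the absence of a rule;
-- at most one rule applies to any i and s.
data Run (X : InstructionSequence) : ℕ → State → List Basic → State → Set where
  halt  : ∀ {i s} → fetch X i ≡ just ! → Run X i s [] s
  jump  : ∀ {i s l t s′} → fetch X i ≡ just (# suc l) →
          Run X (i + suc l) s t s′ → Run X i s t s′
  plain : ∀ {i s a t s′} → fetch X i ≡ just (plain a) →
          Run X (i + 1) (effect a s) t s′ → Run X i s (a ∷ t) s′
  pos   : ∀ {i s a t s′} → fetch X i ≡ just (+ a) →
          Run X (i + (if reply a s then 1 else 2)) (effect a s) t s′ →
          Run X i s (a ∷ t) s′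
  neg   : ∀ {i s a t s′} → fetch X i ≡ just (- a) →
          Run X (i + (if reply a s then 2 else 1)) (effect a s) t s′ →
          Run X i s (a ∷ t) s′

-- The contents of the input registers beyond the n-th are left arbitrary.
record Initial {n : ℕ} (bs : Vec Bool n) (s : State) : Set where
  field
    inputs      : ∀ (j : Fin n) → s (inp (toℕ j)) ≡ lookup bs j
    auxiliaries : ∀ i → s (aux i) ≡ false
    output      : s out ≡ false

InputsBelow : ℕ → Basic → Set
InputsBelow n (f ∙ m) = ∀ {j} → f ≡ inp j → j < n

_Computes_ : ∀ {n} → InstructionSequence → (Vec Bool n → Bool) → Set
_Computes_ {n} X f =
  ∀ (bs : Vec Bool n) (s : State) → Initial bs s →
  ∃₂ λ t s′ → Run X 0 s t s′ × All (InputsBelow n) t × s′ out ≡ f bs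

{-# OPTIONS --safe #-}
module Submission where

open import Defs
open import Data.Bool.Base using (Bool; true; false; not; _∨_; _∧_; if_then_else_)
open import Data.Fin.Base using (Fin; toℕ; fromℕ<)
open import Data.Fin.Properties using (toℕ-fromℕ<)
open import Data.List.Base as List using (List; []; _∷_; _++_; drop; head)
open import Data.List.NonEmpty.Base using (List⁺; _∷_; length; toList; _++⁺_)
open import Data.List.NonEmpty.Properties using (length-++⁺)
import Data.List.Properties as List
open import Data.List.Relation.Unary.All as All using (All; []; _∷_)
import Data.List.Relation.Unary.All.Properties as All
open import Data.Maybe.Base using (just)
open import Data.Nat.Base using (ℕ; suc; _+_; _*_; _≤_)
open import Data.Nat.Properties
  using (+-assoc; +-comm; +-suc; +-mono-≤; +-monoʳ-≤; *-distribˡ-+; ≤-refl; n≤1+n; module ≤-Reasoning)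
open import Data.Nat.Tactic.RingSolver using (solve-∀)
open import Data.Product.Base using (∃; ∃₂; _×_; _,_)
open import Data.Vec.Base using (Vec; lookup)
open import Relation.Binary.PropositionalEquality
  using (_≡_; refl; sym; trans; cong; subst; module ≡-Reasoning)
open import Relation.Nullary.Negation.Core using (¬_)

-- A formula is translated so that it behaves like one big positive test: if the
-- translation is entered at position i and has length k, then it sets no
-- register and control leaves it at i + k if the formula is true and at
-- i + k + 1 if it is false.  Each connective costs at most two jumps, so the
-- length is linear in the size; appending out.set:T ; ! gives the result.

code : Formula → List Instruction
code (var i)   = (+ (inp i ∙ get)) ∷ []
code (neg φ)   = code φ ++ # 2 ∷ []
code (φ or ψ)  = code φ ++ # suc (List.length (code ψ)) ∷ code ψ
code (φ and ψ) = code φ ++ # 2 ∷ # (2 + List.length (code ψ)) ∷ code ψ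

program : Formula → InstructionSequence
program φ = code φ ++⁺ (plain (out ∙ set true) ∷ ! ∷ [])

toList-++⁺ : ∀ {A : Set} (xs : List A) (ys : List⁺ A) → toList (xs ++⁺ ys) ≡ xs ++ toList ys
toList-++⁺ []       ys = refl
toList-++⁺ (x ∷ xs) ys = cong (x ∷_) (toList-++⁺ xs ys)

-- Stricter than `NaBasic`: the only value that may be written to `out` is `true`. One invariant
-- thus yields both membership in `ISbrⁿᵃ` and the absence of `out ∙ set false`.
data Permitted : Basic → Set where
  inp-get : ∀ {i} → Permitted (inp i ∙ get)
  out-set : Permitted (out ∙ set true)

OnlyPermitted : Instruction → Set
OnlyPermitted u = ∀ {a} → u Contains a → Permitted a

code-permitted : ∀ φ → All OnlyPermitted (code φ)
code-permitted (var i)   = (λ { pos → inp-get }) ∷ []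
code-permitted (neg φ)   = All.++⁺ (code-permitted φ) ((λ ()) ∷ [])
code-permitted (φ or ψ)  = All.++⁺ (code-permitted φ) ((λ ()) ∷ code-permitted ψ)
code-permitted (φ and ψ) = All.++⁺ (code-permitted φ) ((λ ()) ∷ (λ ()) ∷ code-permitted ψ)

program-permitted : ∀ φ {a} → a OccursIn program φ → Permitted a
program-permitted φ a∈X
  with permitted , contains ← All.lookupAny
         (subst (All OnlyPermitted) (sym (toList-++⁺ (code φ) _))
           (All.++⁺ (code-permitted φ) ((λ { plain → out-set }) ∷ (λ ()) ∷ []))) a∈X
  = permitted contains

permitted⇒na : ∀ {a} → Permitted a → NaBasic a
permitted⇒na inp-get = inp-get
permitted⇒na out-set = out-set

¬permitted-out-set-false : ¬ Permitted (out ∙ set false)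
¬permitted-out-set-false ()

double-size : ∀ k l → 2 * k + (2 + 2 * l) ≡ 2 * (1 + (k + l))
double-size = solve-∀

-- Each connective raises the bound by 2, which covers the jumps it adds: one for `neg` and `or`,
-- two for `and`.
length-code : ∀ φ → List.length (code φ) ≤ 2 * size φ
length-code (var i)   = n≤1+n 1
length-code (neg φ)   = begin
  List.length (code (neg φ))                         ≡⟨ List.length-++ (code φ) ⟩
  List.length (code φ) + 1                           ≤⟨ +-mono-≤ (length-code φ) (n≤1+n 1) ⟩
  2 * size φ + 2                                     ≡⟨ +-comm (2 * size φ) 2 ⟩
  2 + 2 * size φ                                     ≡⟨ *-distribˡ-+ 2 1 (size φ) ⟨
  2 * size (neg φ)                                   ∎
  where open ≤-Reasoning
length-code (φ or ψ)  = begin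
  List.length (code (φ or ψ))                        ≡⟨ List.length-++ (code φ) ⟩
  List.length (code φ) + (1 + List.length (code ψ))  ≤⟨ +-mono-≤ (length-code φ) (+-mono-≤ (n≤1+n 1) (length-code ψ)) ⟩
  2 * size φ + (2 + 2 * size ψ)                      ≡⟨ double-size (size φ) (size ψ) ⟩
  2 * size (φ or ψ)                                  ∎
  where open ≤-Reasoning
length-code (φ and ψ) = begin
  List.length (code (φ and ψ))                       ≡⟨ List.length-++ (code φ) ⟩
  List.length (code φ) + (2 + List.length (code ψ))  ≤⟨ +-mono-≤ (length-code φ) (+-monoʳ-≤ 2 (length-code ψ)) ⟩
  2 * size φ + (2 + 2 * size ψ)                      ≡⟨ double-size (size φ) (size ψ) ⟩
  2 * size (φ and ψ)                                 ∎
  where open ≤-Reasoning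

length-program : ∀ φ → length (program φ) ≤ 2 * (size φ + 1)
length-program φ = begin
  length (program φ)         ≡⟨ length-++⁺ (code φ) _ ⟩
  -- The two closing instructions are paid for by the `+ 1` in the bound.
  List.length (code φ) + 2   ≤⟨ +-mono-≤ (length-code φ) ≤-refl ⟩
  2 * size φ + 2 * 1         ≡⟨ *-distribˡ-+ 2 (size φ) 1 ⟨
  2 * (size φ + 1)           ∎
  where open ≤-Reasoning

+-length-++ : ∀ {A : Set} i (xs : List A) {ys} →
              i + List.length (xs ++ ys) ≡ i + List.length xs + List.length ys
+-length-++ i xs {ys} = trans (cong (λ k → i + k) (List.length-++ xs))
                              (sym (+-assoc i (List.length xs) (List.length ys)))

-- Phrased with `drop` because `fetch` is the `head` of a `drop`. The unspecified `rest` lets a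
-- fragment be located whatever code follows it.
record Located (X : InstructionSequence) (i : ℕ) (us : List Instruction) : Set where
  constructor located
  field
    {rest}  : List Instruction
    drop≡++ : drop i (toList X) ≡ us ++ rest

located-fetch : ∀ {X i u us} → Located X i (u ∷ us) → fetch X i ≡ just u
located-fetch (located eq) = cong head eq

located-++ˡ : ∀ {X i} us {vs} → Located X i (us ++ vs) → Located X i us
located-++ˡ us {vs} (located {ws} eq) = located (trans eq (List.++-assoc us vs ws))

drop-length-++ : ∀ {A : Set} (xs ys : List A) → drop (List.length xs) (xs ++ ys) ≡ ys
drop-length-++ []       ys = refl
drop-length-++ (x ∷ xs) ys = drop-length-++ xs ys

located-++ʳ : ∀ {X i} us {vs} → Located X i (us ++ vs) → Located X (i + List.length us) vs
located-++ʳ {X} {i} us {vs} (located {ws} eq) = located (begin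
  drop (i + k) (toList X)       ≡⟨ List.drop-drop i k (toList X) ⟨
  drop k (drop i (toList X))    ≡⟨ cong (drop k) eq ⟩
  drop k ((us ++ vs) ++ ws)     ≡⟨ cong (drop k) (List.++-assoc us vs ws) ⟩
  drop k (us ++ vs ++ ws)       ≡⟨ drop-length-++ us (vs ++ ws) ⟩
  vs ++ ws                      ∎)
  where
  open ≡-Reasoning
  k = List.length us

-- The conclusion of `Computes` with the starting position, the state and the final content of `out`
-- left free, so that runs can be built backwards from their end.
Completes : ℕ → InstructionSequence → ℕ → State → Bool → Set
Completes n X i s b = ∃₂ λ t s′ → Run X i s t s′ × All (InputsBelow n) t × s′ out ≡ b

completes-jump : ∀ {n X i s b l us} → Located X i (# suc l ∷ us) →
                 Completes n X (i + suc l) s b → Completes n X i s b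
completes-jump at (t , s′ , run , below , eq) = t , s′ , jump (located-fetch at) run , below , eq

-- Where control leaves a translated formula whose code ends just before position `i`.
exit : Bool → ℕ → ℕ
exit true  i = i
exit false i = suc i

module _ {n : ℕ} {bs : Vec Bool n} {X : InstructionSequence} {s : State} {b : Bool}
         (inputs : ∀ (j : Fin n) → s (inp (toℕ j)) ≡ lookup bs j) where

  C : ℕ → Set
  C i = Completes n X i s b

  -- Continuation-passing form of correctness: a completed run from the exit selected by the value
  -- of `φ` extends back to the entry. The state `s` stays fixed since the code only reads inputs.
  -- In each compound case `leave` continues from the exit of the first subformula.
  completes-code : ∀ φ (vars : VariablesAmong n φ) {i} → Located X i (code φ) →
                   C (exit (induced φ vars bs) (i + List.length (code φ))) → C i
  completes-code (var v) (var v<n) {i} at (t , s′ , run , below , eq) =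
    _ , s′ , pos (located-fetch at) (subst (λ j → Run X j s t s′) (sym position) run)
      , (λ { refl → v<n }) ∷ below , eq
    where
    input : s (inp v) ≡ lookup bs (fromℕ< v<n)
    input = trans (cong (λ w → s (inp w)) (sym (toℕ-fromℕ< v<n))) (inputs (fromℕ< v<n))

    -- A positive test advances by 1 or 2, and these are exactly the two exits of a code of length
    -- 1.
    exit-test : ∀ r → i + (if r then 1 else 2) ≡ exit r (i + 1)
    exit-test true  = refl
    exit-test false = +-suc i 1

    position : i + (if s (inp v) then 1 else 2) ≡ exit (lookup bs (fromℕ< v<n)) (i + 1)
    position = trans (cong (λ r → i + (if r then 1 else 2)) input) (exit-test _)

  completes-code (neg φ) (neg p) {i} at final =
    completes-code φ p (located-++ˡ (code φ) at) (leave (induced φ p bs) final)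
    where
    m = List.length (code φ)

    end : i + List.length (code (neg φ)) ≡ suc (i + m)
    end = trans (+-length-++ i (code φ)) (+-comm (i + m) 1)

    -- The true exit of `φ` holds `# 2`, which jumps to one past the end, the false exit of the
    -- negation. The false exit of `φ` is already the end.
    leave : ∀ r → C (exit (not r) (i + List.length (code (neg φ)))) → C (exit r (i + m))
    leave true  c = completes-jump (located-++ʳ (code φ) at) (subst C (trans (cong suc end) (+-comm 2 (i + m))) c)
    leave false c = subst C end c

  completes-code (φ or ψ) (p or q) {i} at final =
    completes-code φ p (located-++ˡ (code φ) at) (leave (induced φ p bs) final)
    where
    m = List.length (code φ)
    k = List.length (code ψ)

    atψ : Located X (suc (i + m)) (code ψ)
    atψ = subst (λ j → Located X j (code ψ)) (+-comm (i + m) 1)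
            (located-++ʳ (# suc k ∷ []) (located-++ʳ (code φ) at))

    end : i + List.length (code (φ or ψ)) ≡ i + m + suc k
    end = +-length-++ i (code φ)

    -- If `φ` is true, the jump skips `code ψ` and lands on the true exit. If it is false, control
    -- is already at `code ψ`, whose exits are those of the disjunction.
    leave : ∀ r → C (exit (r ∨ induced ψ q bs) (i + List.length (code (φ or ψ)))) → C (exit r (i + m))
    leave true  c = completes-jump (located-++ʳ (code φ) at) (subst C end c)
    leave false c = completes-code ψ q atψ
      (subst (λ j → C (exit (induced ψ q bs) j)) (trans end (+-suc (i + m) k)) c)

  completes-code (φ and ψ) (p and q) {i} at final =
    completes-code φ p (located-++ˡ (code φ) at) (leave (induced φ p bs) final)
    where
    m = List.length (code φ)
    k = List.length (code ψ)

    at-jumps : Located X (i + m) (# 2 ∷ # (2 + k) ∷ code ψ)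
    at-jumps = located-++ʳ (code φ) at

    at-second : Located X (suc (i + m)) (# (2 + k) ∷ code ψ)
    at-second = subst (λ j → Located X j (# (2 + k) ∷ code ψ)) (+-comm (i + m) 1)
                  (located-++ʳ (# 2 ∷ []) at-jumps)

    end : i + List.length (code (φ and ψ)) ≡ i + m + (2 + k)
    end = +-length-++ i (code φ)

    -- If `φ` is true, `# 2` hops over the second jump into `code ψ`. If it is false, control enters
    -- at the second jump, which lands one past the end, on the false exit.
    leave : ∀ r → C (exit (r ∧ induced ψ q bs) (i + List.length (code (φ and ψ)))) → C (exit r (i + m))
    leave true  c = completes-jump at-jumps
      (completes-code ψ q (located-++ʳ (# 2 ∷ # (2 + k) ∷ []) at-jumps)
        (subst (λ j → C (exit (induced ψ q bs) j)) (trans end (sym (+-assoc (i + m) 2 k))) c))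
    leave false c = completes-jump at-second (subst C (cong suc end) c)

computes-program : ∀ {n} φ (vars : VariablesAmong n φ) → program φ Computes induced φ vars
computes-program {n} φ vars bs s initial =
  completes-code inputs φ vars (located (toList-++⁺ (code φ) _)) (finish (induced φ vars bs))
  where
  open Initial initial
  m = List.length (code φ)

  at-set : Located (program φ) m (plain (out ∙ set true) ∷ ! ∷ [])
  at-set = located-++ʳ {i = 0} (code φ)
    (located (trans (toList-++⁺ (code φ) _) (sym (List.++-identityʳ _))))

  at-halt : Located (program φ) (m + 1) (! ∷ [])
  at-halt = located-++ʳ (plain (out ∙ set true) ∷ []) at-set

  -- The true exit is the assignment to `out`. The false exit is the `!` after it, so `out` keeps
  -- its initial `false`.
  finish : ∀ r → Completes n (program φ) (exit r m) s r
  finish true  = _ , _ , plain (located-fetch at-set) (halt (located-fetch at-halt)) , (λ ()) ∷ [] , refl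
  finish false = [] , s , halt (subst (λ j → fetch (program φ) j ≡ just !) (+-comm m 1) (located-fetch at-halt))
                   , [] , output

theorem2 : ∃ λ (c : ℕ) →
    ∀ (n : ℕ) (φ : Formula) (vars : VariablesAmong n φ) →
    ∃ λ (X : InstructionSequence) →
    ISbrⁿᵃ X ×
    ¬ ((out ∙ set false) OccursIn X) ×
    X Computes induced φ vars ×
    length X ≤ c * (size φ + 1)
theorem2 = 2 , λ n φ vars →
  program φ ,
  (λ a∈X → permitted⇒na (program-permitted φ a∈X)) ,
  (λ a∈X → ¬permitted-out-set-false (program-permitted φ a∈X)) ,
  computes-program φ vars ,
  length-program φ
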